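{- The function $\alpha:\mathbb{N}\to\mathbb{N}$, the inverse of the Ackermann function $n\mapsto A(n,n)$, is computable in linear time; that is, there is a deterministic multitape Turing machine which, on input $m\in\mathbb{N}$ written in binary, outputs $\alpha(m)$ in binary within $O(|m|)$ steps.
   Context: $\mathbb{N}=\{0,1,2,\dots\}$. For $n\in\mathbb{N}$, $|n|$ denotes the length of the binary representation of $n$: $|0|=1$ and $|n|=\lfloor\log_2 n\rfloor+1$ for $n\ge 1$. All complexity notions refer to the binary representation of integers, and computations are performed on (deterministic) multitape Turing machines. The Ackermann function $A:\mathbb{N}\times\mathbb{N}\to\mathbb{N}$ is defined, for $k,n\in\mathbb{N}$, by $A(0,n)=2^n$, $A(k,0)=1$, and $A(k+1,n+1)=A(k,A(k+1,n))$. Let $Ack:\mathbb{N}\to\mathbb{N}$ be $Ack(n)=A(n,n)$. For an unbounded nondecreasing function $f:\mathbb{N}\to\mathbb{N}$, its inverse $Inv_f:\mathbb{N}\to\mathbb{N}$ is defined by: $Inv_f(n)$ is the least $k\in\mathbb{N}$ such that $f(k)\ge n$. Put $\alpha=Inv_{Ack}$, i.e. $\alpha(m)$ is the least $k$ with $A(k,k)\ge m$. -}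

module Defs where

open import Data.Digit using (Bit; 0b; 1b; Expansion; fromDigits)
open import Data.Fin.Base using (Fin; zero; suc; toℕ)
open import Data.List.Base as List using (List; []; _∷_; [_]; _++_; length; reverse)
open import Data.List.Properties using (length-reverse; reverse-involutive)
open import Data.Maybe.Base using (Maybe; nothing; just)
open import Data.Nat.Base
open import Data.Nat.Induction using (<-wellFounded)
open import Data.Nat.Logarithm using (⌊log₂_⌋)
open import Data.Nat.Logarithm.Core using (⌊log2⌋)
open import Data.Nat.Properties
open import Data.Product.Base using (∃; ∃₂; _×_; _,_; proj₁; proj₂)
open import Data.Sum.Base using (inj₁; inj₂)
open import Data.Vec.Base as Vec using (Vec; _∷_)
open import Function.Bundles using (_↔_)
open import Induction.WellFounded using (Acc; acc)
open import Relation.Binary.Definitions using (Monotonic₁)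
open import Relation.Binary.PropositionalEquality
  using (_≡_; refl; sym; trans; cong; module ≡-Reasoning)
open import Relation.Nullary using (yes; no; contradiction)
open import Relation.Unary using (Pred; Decidable)

A : ℕ → ℕ → ℕ
A zero    n       = 2 ^ n
A (suc k) zero    = 1
A (suc k) (suc n) = A k (A (suc k) n)

Ack : ℕ → ℕ
Ack n = A n n

n<A : ∀ k n → n < A k n
n<A zero    zero    = s≤s z≤n
n<A zero    (suc n) = begin-strict
  suc n          ≤⟨ n<A zero n ⟩
  2 ^ n          <⟨ ^-monoʳ-< 2 (s≤s (s≤s z≤n)) (n<1+n n) ⟩
  2 ^ suc n      ∎
  where open ≤-Reasoning
n<A (suc k) zero    = s≤s z≤n
n<A (suc k) (suc n) = ≤-trans (s≤s (n<A (suc k) n)) (n<A k (A (suc k) n))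

A-step : ∀ k n → A k n ≤ A k (suc n)
A-step zero    n = ^-monoʳ-≤ 2 (n≤1+n n)
A-step (suc k) n = <⇒≤ (n<A k (A (suc k) n))

A-monoʳ : ∀ k → Monotonic₁ _≤_ _≤_ (A k)
A-monoʳ k {m} m≤n = go (≤⇒≤′ m≤n)
  where
  go : ∀ {n} → m ≤′ n → A k m ≤ A k n
  go (≤′-reflexive refl) = ≤-refl
  go (≤′-step m≤′n)      = ≤-trans (go m≤′n) (A-step k _)

A-monoˡ-step : ∀ k n → A k n ≤ A (suc k) n
A-monoˡ-step zero    zero    = ≤-refl
A-monoˡ-step (suc k) zero    = ≤-refl
A-monoˡ-step k       (suc n) = A-monoʳ k (n<A (suc k) n)

Ack-mono : Monotonic₁ _≤_ _≤_ Ack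
Ack-mono {m} m≤n = go (≤⇒≤′ m≤n)
  where
  go : ∀ {n} → m ≤′ n → Ack m ≤ Ack n
  go (≤′-reflexive refl)   = ≤-refl
  go (≤′-step {n} m≤′n)    =
    ≤-trans (go m≤′n) (≤-trans (A-step n n) (A-monoˡ-step n (suc n)))

Unbounded : (ℕ → ℕ) → Set
Unbounded f = ∀ n → ∃ λ k → n ≤ f k

least : ∀ {ℓ} {P : Pred ℕ ℓ} → Decidable P → ∀ n → P n →
        ∃ λ k → P k × (∀ j → P j → k ≤ j)
least P? zero    p = zero , p , λ _ _ → z≤n
least P? (suc n) p with P? zero
... | yes p₀ = zero , p₀ , λ _ _ → z≤n
... | no ¬p₀ with least (λ i → P? (suc i)) n p
...   | k , pk , k≤ = suc k , pk , λ where
        zero    p₀ → contradiction p₀ ¬p₀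
        (suc j) pj → s≤s (k≤ j pj)

Inv : (f : ℕ → ℕ) → Monotonic₁ _≤_ _≤_ f → Unbounded f → ℕ → ℕ
Inv f _ unbounded n =
  let k , n≤fk = unbounded n in proj₁ (least (λ i → n ≤? f i) k n≤fk)

Ack-unbounded : Unbounded Ack
Ack-unbounded n = n , <⇒≤ (n<A n n)

α : ℕ → ℕ
α = Inv Ack Ack-mono Ack-unbounded

increment : Expansion 2 → Expansion 2
increment []             = [ 1b ]
increment (zero ∷ ds)    = 1b ∷ ds
increment (suc zero ∷ ds) = 0b ∷ increment ds

-- Least significant digit first, as in Data.Digit.
bits : ℕ → Expansion 2
bits zero    = [ 0b ]
bits (suc n) = increment (bits n)

-- Most significant digit first; no leading zeros, except that zero is
-- written as the single digit 0 (see fromDigits-binary, length-binary).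
binary : ℕ → List Bit
binary n = reverse (bits n)

∣_∣₂ : ℕ → ℕ
∣ n ∣₂ = length (binary n)

fromDigits-increment : ∀ ds → fromDigits (increment ds) ≡ suc (fromDigits ds)
fromDigits-increment []              = refl
fromDigits-increment (zero ∷ ds)     = refl
fromDigits-increment (suc zero ∷ ds) = cong (_* 2) (fromDigits-increment ds)

fromDigits-binary : ∀ n → fromDigits (reverse (binary n)) ≡ n
fromDigits-binary n = trans (cong fromDigits (reverse-involutive (bits n))) (go n)
  where
  go : ∀ n → fromDigits (bits n) ≡ n
  go zero    = refl
  go (suc n) = trans (fromDigits-increment (bits n)) (cong suc (go n))

bits-halve : ∀ n → ∃ λ b → bits (2+ n) ≡ b ∷ bits (suc ⌊ n /2⌋)
bits-halve zero          = 0b , refl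
bits-halve (suc zero)    = 1b , refl
bits-halve (suc (suc n)) with bits-halve n
... | zero     , eq = 0b , cong (λ ds → increment (increment ds)) eq
... | suc zero , eq = 1b , cong (λ ds → increment (increment ds)) eq

length-binary : ∀ n → ∣ n ∣₂ ≡ ⌊log₂ n ⌋ + 1
length-binary n = begin
  ∣ n ∣₂            ≡⟨ length-reverse (bits n) ⟩
  length (bits n)   ≡⟨ go n (<-wellFounded n) ⟩
  1 + ⌊log₂ n ⌋     ≡⟨ +-comm 1 ⌊log₂ n ⌋ ⟩
  ⌊log₂ n ⌋ + 1     ∎
  where
  open ≡-Reasoning
  go : ∀ n (rs : Acc _<_ n) → length (bits n) ≡ 1 + ⌊log2⌋ n rs
  go 0            _        = refl
  go 1            _        = refl
  go (suc (suc n)) (acc rs) =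
    trans (cong length (proj₂ (bits-halve n))) (cong suc (go (suc ⌊ n /2⌋) _))

Finite : Set → Set
Finite X = ∃ λ n → X ↔ Fin n

data Symbol (X : Set) : Set where
  blank : Symbol X
  bit   : Bit → Symbol X
  aux   : X → Symbol X

-- A two-way infinite tape.  The cells to the left of the head are listed
-- from the nearest one outwards, and so are those to its right; all cells
-- beyond the two lists are blank.
record Tape (X : Set) : Set where
  constructor tape
  field
    left  : List (Symbol X)
    head  : Symbol X
    right : List (Symbol X)

data Move : Set where
  L S R : Move

module _ {X : Set} where

  blankTape : Tape X
  blankTape = tape [] blank []

  -- The head is on the first symbol of the word.
  wordTape : List Bit → Tape X
  wordTape []       = blankTape
  wordTape (b ∷ bs) = tape [] (bit b) (List.map bit bs)

  move : Move → Tape X → Tape X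
  move L (tape []       x rs)       = tape [] blank (x ∷ rs)
  move L (tape (l ∷ ls) x rs)       = tape ls l (x ∷ rs)
  move S t                          = t
  move R (tape ls       x [])       = tape (x ∷ ls) blank []
  move R (tape ls       x (r ∷ rs)) = tape (x ∷ ls) r rs

  act : Symbol X × Move → Tape X → Tape X
  act (y , d) (tape ls x rs) = move d (tape ls y rs)

  contents : Tape X → List (Symbol X)
  contents (tape ls x rs) = reverse ls ++ x ∷ rs

  -- The word is written on the tape, in consecutive cells, and all other
  -- cells are blank; the position of the head is irrelevant.
  _Holds_ : Tape X → List Bit → Set
  t Holds w = ∃₂ λ i j →
    contents t ≡ List.replicate i blank ++ List.map bit w ++ List.replicate j blank

record Configuration (Q X : Set) (n : ℕ) : Set where
  constructor config
  field
    state   : Q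
    onTapes : Vec (Tape X) n

-- There are 1 + extraTapes tapes.  The machine halts when δ is nothing.
record TuringMachine : Set₁ where
  field
    extraTapes   : ℕ
    State        : Set
    Aux          : Set
    finite-State : Finite State
    finite-Aux   : Finite Aux
    start        : State

  tapes : ℕ
  tapes = suc extraTapes

  field
    δ : State → Vec (Symbol Aux) tapes →
        Maybe (State × Vec (Symbol Aux × Move) tapes)

  Config : Set
  Config = Configuration State Aux tapes

  initial : List Bit → Config
  initial w = config start (wordTape w ∷ Vec.replicate extraTapes blankTape)

  output : Config → Tape Aux
  output (config _ ts) = Vec.last ts

  step : Config → Maybe Config
  step (config q ts) with δ q (Vec.map Tape.head ts)
  ... | nothing         = nothing
  ... | just (q′ , as)  = just (config q′ (Vec.zipWith act as ts))

  -- c ⇓[ t ] d: started in c, the machine halts in d after exactly t steps.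
  data _⇓[_]_ : Config → ℕ → Config → Set where
    halt : ∀ {c} → step c ≡ nothing → c ⇓[ 0 ] c
    next : ∀ {c c′ d t} → step c ≡ just c′ → c′ ⇓[ t ] d → c ⇓[ suc t ] d

-- Numbers are written in binary: the input on the first tape, the output on
-- the last one.  The time bound is a function of the length of the input.
_computes_inTime_ : TuringMachine → (ℕ → ℕ) → (ℕ → ℕ) → Set
M computes f inTime T =
  ∀ m → ∃₂ λ t c → initial (binary m) ⇓[ t ] c × t ≤ T ∣ m ∣₂ × output c Holds binary (f m)
  where open TuringMachine M

-- ∣ m ∣₂ is never 0, so a bound O(∣ m ∣₂) for all m is one of this form.
LinearTimeComputable : (ℕ → ℕ) → Set₁
LinearTimeComputable f = ∃₂ λ M C → M computes f inTime (λ n → C * n)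

{-# OPTIONS --safe #-}

-- Let f k be the inverse of A k.  Since A (suc k) iterates A k from 1, and
-- A 0 iterates doubling from 1, f (suc k) v is the number of times f k has to
-- be applied to v to reach 1, and f 0 v is the number of halvings, rounded up.
-- Running these iterations as an odometer with one digit per level, "while
-- v > 1, halve v and increment digit 0; when v = 1, load v from the current
-- digit, clear it, and increment the next one", produces f 1 m, f 2 m, …, in
-- turn as the carries open new levels, and α m is the first k with f k m ≤ k.
-- A single scan of the input yields f 0 m in unary.  Computing f 1 m from it
-- takes linear time because the halved values shrink geometrically; everything
-- after that costs at most exponential time in f 1 m ≈ log* m.
module Submission where

open import Defs

open import Data.Digit using (Bit; 0b; 1b; fromDigits)
open import Data.Fin.Base using (Fin; zero; suc; toℕ)
open import Data.Fin.Properties using (toℕ<n)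
open import Data.List.Base as List using (List; []; _∷_; _++_; length; replicate; reverse)
open import Data.List.Properties
open import Data.Maybe.Base using (Maybe; nothing; just)
open import Data.Nat.Base
open import Data.Nat.Induction using (<-wellFounded)
open import Data.Nat.Properties
open import Data.Nat.Tactic.RingSolver using (solve-∀)
open import Data.Product.Base using (∃; ∃₂; _×_; _,_)
open import Data.Vec.Base as Vec using (Vec; []; _∷_)
open import Data.Vec.Relation.Binary.Pointwise.Inductive as Pointwise using (Pointwise; []; _∷_)
open import Data.Sum.Base using (inj₁; inj₂)
open import Function.Base using (_∘_)
open import Function.Bundles using (_⇔_; mk⇔; Equivalence)
open import Function.Construct.Identity using (↔-id)
open import Induction.WellFounded using (Acc; acc)
open import Relation.Binary.PropositionalEquality
open import Relation.Nullary using (yes; no; contradiction)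

open Equivalence using (to; from)

-- Tapes up to trailing blanks

module _ {X : Set} where

  infix 4 _≋_ _≈_

  -- The left-hand side may have additional blanks at its end.
  data _≋_ : List (Symbol X) → List (Symbol X) → Set where
    []  : [] ≋ []
    pad : ∀ {xs} → xs ≋ [] → blank ∷ xs ≋ []
    _∷_ : ∀ x {xs ys} → xs ≋ ys → x ∷ xs ≋ x ∷ ys

  data _≈_ : Tape X → Tape X → Set where
    tape : ∀ ls x {rs rs′} → rs ≋ rs′ → tape ls x rs ≈ tape ls x rs′

  ≋-refl : ∀ {xs} → xs ≋ xs
  ≋-refl {[]}     = []
  ≋-refl {x ∷ xs} = x ∷ ≋-refl

  ≈-refl : ∀ {t} → t ≈ t
  ≈-refl {tape ls x rs} = tape ls x ≋-refl

  ≋[]⇒blanks : ∀ {xs} → xs ≋ [] → ∃ λ j → xs ≡ replicate j blank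
  ≋[]⇒blanks []      = 0 , refl
  ≋[]⇒blanks (pad p) with ≋[]⇒blanks p
  ... | j , refl = suc j , refl

  infixr 5 _▹_

  -- A blank put in front of an empty right part is dropped, so counters and stacks keep their
  -- normal form and most steps of the machine hold by `refl`.
  _▹_ : Symbol X → List (Symbol X) → List (Symbol X)
  blank ▹ [] = []
  x     ▹ xs = x ∷ xs

  ▹-≋ : ∀ x {xs ys} → xs ≋ ys → x ∷ xs ≋ x ▹ ys
  ▹-≋ blank   []      = pad []
  ▹-≋ blank   (pad p) = pad (pad p)
  ▹-≋ blank   (x ∷ p) = blank ∷ x ∷ p
  ▹-≋ (bit b) p       = bit b ∷ p
  ▹-≋ (aux a) p       = aux a ∷ p

  trimmedMove : Move → Tape X → Tape X
  trimmedMove L (tape []       x rs) = tape [] blank (x ▹ rs)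
  trimmedMove L (tape (l ∷ ls) x rs) = tape ls l (x ▹ rs)
  trimmedMove S t                    = t
  trimmedMove R t                    = move R t

  trimmedAct : Symbol X × Move → Tape X → Tape X
  trimmedAct (y , d) (tape ls x rs) = trimmedMove d (tape ls y rs)

  act-≈ : ∀ a {t t′} → t ≈ t′ → act a t ≈ trimmedAct a t′
  act-≈ (y , L) (tape []       x p)       = tape [] blank (▹-≋ y p)
  act-≈ (y , L) (tape (l ∷ ls) x p)       = tape ls l (▹-≋ y p)
  act-≈ (y , S) (tape ls       x p)       = tape ls y p
  act-≈ (y , R) (tape ls       x [])      = tape (y ∷ ls) blank []
  act-≈ (y , R) (tape ls       x (pad p)) = tape (y ∷ ls) blank p
  act-≈ (y , R) (tape ls       x (r ∷ p)) = tape (y ∷ ls) r p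

  heads-≈ : ∀ {n} {ts ts′ : Vec (Tape X) n} → Pointwise _≈_ ts ts′ →
            Vec.map Tape.head ts ≡ Vec.map Tape.head ts′
  heads-≈ []                = refl
  heads-≈ (tape ls x p ∷ ps) = cong (x ∷_) (heads-≈ ps)

  acts-≈ : ∀ {n} (as : Vec (Symbol X × Move) n) {ts ts′} → Pointwise _≈_ ts ts′ →
           Pointwise _≈_ (Vec.zipWith act as ts) (Vec.zipWith trimmedAct as ts′)
  acts-≈ []       []       = []
  acts-≈ (a ∷ as) (p ∷ ps) = act-≈ a p ∷ acts-≈ as ps

  last-≈ : ∀ {n} {ts ts′ : Vec (Tape X) (suc n)} → Pointwise _≈_ ts ts′ →
           Vec.last ts ≈ Vec.last ts′
  last-≈ (p ∷ [])      = p
  last-≈ (p ∷ q ∷ ps) = last-≈ (q ∷ ps)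

module Trimmed (M : TuringMachine) where

  open TuringMachine M

  trimmedStep : Config → Maybe Config
  trimmedStep (config q ts) with δ q (Vec.map Tape.head ts)
  ... | nothing        = nothing
  ... | just (q′ , as) = just (config q′ (Vec.zipWith trimmedAct as ts))

  infix 4 _⟶[_]_

  -- The number in brackets is an upper bound for the number of steps.
  data _⟶[_]_ : Config → ℕ → Config → Set where
    done : ∀ {c t} → c ⟶[ t ] c
    _▻_  : ∀ {c c′ d t} → trimmedStep c ≡ just c′ → c′ ⟶[ t ] d → c ⟶[ suc t ] d

  infixr 4 _▻_ _▻▻_

  weaken : ∀ {c d s t} → s ≤ t → c ⟶[ s ] d → c ⟶[ t ] d
  weaken s≤t       done     = done
  weaken (s≤s s≤t) (e ▻ es) = e ▻ weaken s≤t es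

  _▻▻_ : ∀ {c d e s t} → c ⟶[ s ] d → d ⟶[ t ] e → c ⟶[ s + t ] e
  _▻▻_ {s = s} {t} done es = weaken (m≤n+m t s) es
  (e ▻ es) ▻▻ es′          = e ▻ (es ▻▻ es′)

  halts-≈ : ∀ {q ts ts′} → Pointwise _≈_ ts ts′ →
            trimmedStep (config q ts′) ≡ nothing → step (config q ts) ≡ nothing
  halts-≈ {q} {ts′ = ts′} ps e rewrite heads-≈ ps with δ q (Vec.map Tape.head ts′)
  ... | nothing = refl

  step-≈ : ∀ {q q′ ts ts′ us′} → Pointwise _≈_ ts ts′ →
           trimmedStep (config q ts′) ≡ just (config q′ us′) →
           ∃ λ us → step (config q ts) ≡ just (config q′ us) × Pointwise _≈_ us us′
  step-≈ {q} {ts′ = ts′} ps e rewrite heads-≈ ps with δ q (Vec.map Tape.head ts′) | e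
  ... | just (_ , as) | refl = _ , refl , acts-≈ as ps

  -- Transitions depend only on the scanned symbols, which related tapes share, so real and trimmed
  -- runs proceed in lockstep.
  simulate : ∀ {q ts ts′ T d} → Pointwise _≈_ ts ts′ →
             config q ts′ ⟶[ T ] d → trimmedStep d ≡ nothing →
             ∃₂ λ t e → config q ts ⇓[ t ] e × t ≤ T × output e ≈ output d
  simulate ps done     stop = 0 , _ , halt (halts-≈ ps stop) , z≤n , last-≈ ps
  simulate ps (e ▻ es) stop with step-≈ ps e
  ... | us , e′ , ps′ with simulate ps′ es stop
  ...   | t , d , run , t≤T , out = suc t , d , next e′ run , s≤s t≤T , out

-- A Turing machine for α

pattern seven+ q = suc (suc (suc (suc (suc (suc (suc q))))))

pattern starting   = zero
pattern leading    = suc zero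
pattern powerOfTwo = suc (suc zero)
pattern nonPower   = suc (suc (suc zero))
pattern pushing    = suc (suc (suc (suc zero)))
pattern halvingE   = suc (suc (suc (suc (suc zero))))
pattern halvingO   = suc (suc (suc (suc (suc (suc zero)))))
pattern copying    = seven+ zero
pattern deciding   = seven+ (suc zero)
pattern popping    = seven+ (suc (suc zero))
pattern comparing  = seven+ (suc (suc (suc zero)))
pattern restoring  = seven+ (suc (suc (suc (suc zero))))
pattern carrying   = seven+ (suc (suc (suc (suc (suc zero)))))
pattern refilling  = seven+ (suc (suc (suc (suc (suc (suc zero))))))

pattern six a b c d e f = a ∷ b ∷ c ∷ d ∷ e ∷ f ∷ []

pattern O = bit zero
pattern I = bit (suc zero)

Sym : Set
Sym = Symbol (Fin 0)

-- The tapes are: the input; a unary counter for v - 1; a scratch counter; the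
-- digits of the odometer in unary, separated by 0s, digit 0 on top; the level
-- as a counter; the level in binary.  A counter is the distance of the
-- head from a marker 0.  In the state deciding, the digits below the level
-- are cleared and not on the stack, and the digit at the level is one more
-- than the stack says: the increment is written only when v is halved.
δ : Fin 14 → Vec Sym 6 → Maybe (Fin 14 × Vec (Sym × Move) 6)
δ starting   (six i v u s l o) =
  just (leading , six (i , S) (O , S) (O , S) (s , S) (O , S) (O , R))
δ leading    (six O v u s l o) =
  just (leading , six (O , R) (v , S) (u , S) (s , S) (l , S) (o , S))
δ leading    (six I v u s l o) =
  just (powerOfTwo , six (I , R) (v , S) (u , S) (s , S) (l , S) (o , S))
δ powerOfTwo (six O v u s l o) =
  just (powerOfTwo , six (O , R) (v , R) (u , S) (s , S) (l , S) (o , S))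
δ powerOfTwo (six I v u s l o) =
  just (nonPower , six (I , R) (v , R) (u , S) (s , S) (l , S) (o , S))
δ powerOfTwo (six blank blank u s l o) =
  just (comparing , six (blank , S) (blank , L) (u , S) (s , S) (l , S) (o , S))
δ nonPower   (six (bit b) v u s l o) =
  just (nonPower , six (bit b , R) (v , R) (u , S) (s , S) (l , S) (o , S))
δ nonPower   (six blank v u s l o) =
  just (comparing , six (blank , S) (v , S) (u , S) (s , S) (l , S) (o , S))
δ pushing    (six i v u s blank o) =
  just (pushing , six (i , S) (v , S) (u , S) (O , R) (blank , L) (o , S))
δ pushing    (six i v u s O o) =
  just (halvingE , six (i , S) (v , S) (u , S) (s , S) (O , S) (o , S))
δ halvingE   (six i blank u s l o) =
  just (halvingO , six (i , S) (blank , L) (u , S) (s , S) (l , S) (o , S))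
δ halvingE   (six i O u s l o) =
  just (copying , six (i , S) (O , S) (u , S) (s , S) (l , S) (o , S))
δ halvingO   (six i blank u s l o) =
  just (halvingE , six (i , S) (blank , L) (u , R) (s , S) (l , S) (o , S))
δ halvingO   (six i O u s l o) =
  just (copying , six (i , S) (O , S) (u , S) (s , S) (l , S) (o , S))
δ copying    (six i v blank s l o) =
  just (copying , six (i , S) (v , R) (blank , L) (s , S) (l , S) (o , S))
δ copying    (six i v O s l o) =
  just (deciding , six (i , S) (v , S) (O , S) (s , S) (l , S) (o , S))
δ deciding   (six i blank u s l o) =
  just (pushing , six (i , S) (blank , S) (u , S) (I , R) (l , S) (o , S))
δ deciding   (six i O u s l o) =
  just (popping , six (i , S) (O , S) (u , S) (blank , L) (l , S) (o , S))
δ popping    (six i v u I l o) =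
  just (popping , six (i , S) (v , R) (u , S) (blank , L) (l , S) (o , S))
δ popping    (six i v u O l o) =
  just (deciding , six (i , S) (v , S) (u , S) (blank , S) (l , R) (o , S))
δ popping    (six i v u blank l o) =
  just (comparing , six (i , S) (v , S) (u , S) (blank , S) (l , S) (o , S))
δ comparing  (six i v u s O o) =
  just (restoring , six (i , S) (v , S) (u , S) (s , S) (O , S) (o , S))
δ comparing  (six i blank u s blank o) =
  just (comparing , six (i , S) (blank , L) (u , R) (s , S) (blank , L) (o , S))
δ restoring  (six i v blank s l o) =
  just (restoring , six (i , S) (v , R) (blank , L) (s , S) (l , R) (o , S))
δ restoring  (six i v O s l o) =
  just (carrying , six (i , S) (v , S) (O , S) (s , S) (l , R) (blank , L))
δ carrying   (six i v u s l I) =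
  just (carrying , six (i , S) (v , S) (u , R) (s , S) (l , S) (blank , L))
δ carrying   (six i v u s l O) =
  just (refilling , six (i , S) (v , S) (u , S) (s , S) (l , S) (I , R))
δ carrying   (six i v u s l blank) =
  just (refilling , six (i , S) (v , S) (u , S) (s , S) (l , S) (I , R))
δ refilling  (six i v blank s l o) =
  just (refilling , six (i , S) (v , S) (blank , L) (s , S) (l , S) (O , R))
δ refilling  (six i v O s l o) =
  just (deciding , six (i , S) (v , S) (O , S) (s , S) (l , S) (o , S))
-- Halting happens here: in `comparing` when the value reaches 0 before the level does, and in
-- `leading` and `powerOfTwo` on the inputs 0 and 1.
δ _ _ = nothing

machine : TuringMachine
machine = record
  { extraTapes   = 5
  ; State        = Fin 14
  ; Aux          = Fin 0
  ; finite-State = 14 , ↔-id _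
  ; finite-Aux   = 0 , ↔-id _
  ; start        = starting
  ; δ            = δ
  }

open TuringMachine machine using (Config)
open Trimmed machine

-- Runs of the machine

top : ℕ → Sym
top zero    = O
top (suc n) = blank

below : ℕ → List Sym
below zero    = []
below (suc n) = top n ∷ below n

counter : ℕ → Tape (Fin 0)
counter n = tape (below n) (top n) []

stack : List Bit → Tape (Fin 0)
stack bs = tape (List.map bit bs) blank []

peek : List Bit → Tape (Fin 0)
peek []       = blankTape
peek (b ∷ bs) = tape (List.map bit bs) (bit b) []

moveL-stack : ∀ bs → trimmedMove L (stack bs) ≡ peek bs
moveL-stack []       = refl
moveL-stack (b ∷ bs) = refl

conf : Fin 14 → Tape (Fin 0) → ℕ → ℕ → Tape (Fin 0) → ℕ → Tape (Fin 0) → Config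
conf q i v u s l o = config q (six i (counter v) (counter u) s (counter l) o)

module _ {i s : Tape (Fin 0)} {l : ℕ} {o : Tape (Fin 0)} where

  -- The two states track parity, and `u` advances on every second step. Rounding down is right
  -- because the counter holds the actual value minus 1, which is to be halved rounding up.
  halve : ∀ v u → conf halvingE i v u s l o ⟶[ suc v ] conf copying i 0 (⌊ v /2⌋ + u) s l o
  halve 0            u = refl ▻ done
  halve 1            u = refl ▻ refl ▻ done
  halve (suc (suc v)) u = refl ▻ refl ▻
    subst (λ x → conf halvingE i v (suc u) s l o ⟶[ suc v ] conf copying i 0 x s l o)
      (+-suc ⌊ v /2⌋ u) (halve v (suc u))

  copy : ∀ u v → conf copying i v u s l o ⟶[ suc u ] conf deciding i (u + v) 0 s l o
  copy zero    v = refl ▻ done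
  copy (suc u) v = refl ▻
    subst (λ x → conf copying i (suc v) u s l o ⟶[ suc u ] conf deciding i x 0 s l o)
      (+-suc u v) (copy u (suc v))

module _ {i : Tape (Fin 0)} {l : ℕ} {o : Tape (Fin 0)} where

  pop-ones : ∀ d bs v → conf popping i v 0 (peek (replicate d 1b ++ bs)) l o ⟶[ d ]
                        conf popping i (d + v) 0 (peek bs) l o
  pop-ones zero    bs v = done
  pop-ones (suc d) bs v =
    cong (λ s → just (conf popping i (suc v) 0 s l o)) (moveL-stack (replicate d 1b ++ bs)) ▻
    subst (λ x → conf popping i (suc v) 0 (peek (replicate d 1b ++ bs)) l o ⟶[ d ]
                 conf popping i x 0 (peek bs) l o)
      (+-suc d v) (pop-ones d bs (suc v))

  start-popping : ∀ bs → trimmedStep (conf deciding i 0 0 (stack bs) l o) ≡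
                         just (conf popping i 0 0 (peek bs) l o)
  start-popping bs = cong (λ s → just (conf popping i 0 0 s l o)) (moveL-stack bs)

  carry-up : ∀ d bs → conf deciding i 0 0 (stack (replicate d 1b ++ 0b ∷ bs)) l o ⟶[ suc (d + 1) ]
                      conf deciding i d 0 (stack bs) (suc l) o
  carry-up d bs = start-popping _ ▻
    subst (λ x → conf popping i 0 0 (peek (replicate d 1b ++ 0b ∷ bs)) l o ⟶[ d + 1 ]
                 conf deciding i x 0 (stack bs) (suc l) o)
      (+-identityʳ d) (pop-ones d (0b ∷ bs) 0 ▻▻ refl ▻ done)

  -- No separator lies under the bottom digit: its level is the highest one open, so its value is
  -- the next to be compared with the level.
  complete : ∀ d → conf deciding i 0 0 (stack (replicate d 1b ++ [])) l o ⟶[ suc (d + 1) ]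
                   conf comparing i d 0 (stack []) l o
  complete d = start-popping (replicate d 1b ++ []) ▻
    subst (λ x → conf popping i 0 0 (peek (replicate d 1b ++ [])) l o ⟶[ d + 1 ]
                 conf comparing i x 0 (stack []) l o)
      (+-identityʳ d) (pop-ones d [] 0 ▻▻ refl ▻ done)

-- Inverting and iterating, level by level

-- A k (suc j) ≡ G k (A k j), which makes every A k an iterate, including A 0.
G : ℕ → ℕ → ℕ
G zero    y = 2 * y
G (suc k) y = A k y

A-suc : ∀ k j → A k (suc j) ≡ G k (A k j)
A-suc zero    j = refl
A-suc (suc k) j = refl

A-zero : ∀ k → A k 0 ≡ 1
A-zero zero    = refl
A-zero (suc k) = refl

-- The values here are those on the machine, v - 1 for the actual v.  A Sink
-- applies the inverse of G k, a Count iterates it until the value is 0.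
sinkCost : ℕ → ℕ
sinkCost zero    = 5
sinkCost (suc k) = 2 * sinkCost k + 5

countCost : ℕ → ℕ → ℕ
countCost k u = (1 + sinkCost k) * (2 * u)

record Sink (k w : ℕ) : Set where
  field
    value    : ℕ
    shrinks  : 2 * value ≤ w
    adjoint  : ∀ y → value < y ⇔ w < G k y
    run      : ∀ i bs o → conf pushing i w 0 (stack bs) k o ⟶[ sinkCost k * w ]
                          conf deciding i value 0 (stack bs) k o

record Count (k u : ℕ) : Set where
  field
    value   : ℕ
    adjoint : ∀ j → value ≤ j ⇔ u < A k j
    run     : ∀ i d bs o →
              conf deciding i u 0 (stack (replicate d 1b ++ bs)) k o ⟶[ countCost k u ]
              conf deciding i 0 0 (stack (replicate (value + d) 1b ++ bs)) k o

  value≤ : value ≤ u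
  value≤ = from (adjoint u) (n<A k u)

⌊n/2⌋+⌊n/2⌋≤n : ∀ n → 2 * ⌊ n /2⌋ ≤ n
⌊n/2⌋+⌊n/2⌋≤n n = begin
  2 * ⌊ n /2⌋           ≡⟨ cong (⌊ n /2⌋ +_) (+-identityʳ _) ⟩
  ⌊ n /2⌋ + ⌊ n /2⌋     ≤⟨ +-monoʳ-≤ ⌊ n /2⌋ (⌊n/2⌋≤⌈n/2⌉ n) ⟩
  ⌊ n /2⌋ + ⌈ n /2⌉     ≡⟨ ⌊n/2⌋+⌈n/2⌉≡n n ⟩
  n                     ∎
  where open ≤-Reasoning

⌊n/2⌋<y⇒n<2y : ∀ n y → ⌊ n /2⌋ < y → n < 2 * y
⌊n/2⌋<y⇒n<2y 0             (suc y) _ = s≤s z≤n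
⌊n/2⌋<y⇒n<2y 1             (suc y) _ = s≤s (≤-trans (s≤s z≤n) (≤-reflexive (sym (+-suc y _))))
⌊n/2⌋<y⇒n<2y (suc (suc n)) (suc y) (s≤s p) =
  subst (suc (suc n) <_) (sym (*-suc 2 y)) (s≤s (s≤s (⌊n/2⌋<y⇒n<2y n y p)))

n<2y⇒⌊n/2⌋<y : ∀ n y → n < 2 * y → ⌊ n /2⌋ < y
n<2y⇒⌊n/2⌋<y n y n<2y = *-cancelˡ-< 2 _ _ (≤-<-trans (⌊n/2⌋+⌊n/2⌋≤n n) n<2y)

sink-zero : ∀ w → 0 < w → Sink 0 w
sink-zero w 0<w = record
  { value   = ⌊ w /2⌋
  ; shrinks = ⌊n/2⌋+⌊n/2⌋≤n w
  ; adjoint = λ y → mk⇔ (⌊n/2⌋<y⇒n<2y w y) (n<2y⇒⌊n/2⌋<y w y)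
  ; run     = λ i bs o → weaken enough (refl ▻ halve w 0 ▻▻ subst
      (λ x → conf copying i 0 (⌊ w /2⌋ + 0) (stack bs) 0 o ⟶[ suc (⌊ w /2⌋ + 0) ]
             conf deciding i x 0 (stack bs) 0 o)
      (trans (+-identityʳ _) (+-identityʳ _)) (copy (⌊ w /2⌋ + 0) 0))
  }
  where
  open ≤-Reasoning
  regroup : ∀ w h → suc (suc w + suc (h + 0)) ≡ w + h + 3 * 1
  regroup = solve-∀
  collect : ∀ w → w + w + 3 * w ≡ 5 * w
  collect = solve-∀
  -- The three constant steps are charged to `w`, which is positive.
  enough : suc (suc w + suc (⌊ w /2⌋ + 0)) ≤ 5 * w
  enough = begin
    suc (suc w + suc (⌊ w /2⌋ + 0))  ≡⟨ regroup w ⌊ w /2⌋ ⟩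
    w + ⌊ w /2⌋ + 3 * 1              ≤⟨ +-mono-≤ (+-monoʳ-≤ w (⌊n/2⌋≤n w)) (*-monoʳ-≤ 3 0<w) ⟩
    w + w + 3 * w                    ≡⟨ collect w ⟩
    5 * w                            ∎

value<w : ∀ {k w} (sk : Sink k w) → 0 < w → Sink.value sk < w
value<w sk 0<w = *-cancelˡ-< 2 _ _ (≤-<-trans (Sink.shrinks sk) (m<m+n _ (≤-trans 0<w (m≤m+n _ 0))))

-- Every application of the sink is preceded by pushing a 1, so the digit counts applications, and
-- the two adjunctions compose along `A-suc`. As values at least halve each time, the costs sum to
-- at most twice the first.
sink⇒count : ∀ k → (∀ w → 0 < w → Sink k w) → ∀ u → Acc _<_ u → Count k u
sink⇒count k sinks zero    _        = record
  { value   = 0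
  ; adjoint = λ j → mk⇔ (λ _ → ≤-<-trans z≤n (n<A k j)) (λ _ → z≤n)
  ; run     = λ i d bs o → done
  }
sink⇒count k sinks u@(suc _) (acc rs) = record
  { value   = suc c.value
  ; adjoint = adjoint
  ; run     = λ i d bs o → weaken enough
      (refl ▻ s.run i (replicate (suc d) 1b ++ bs) o ▻▻
       subst (λ x → conf deciding i s.value 0 (stack (replicate (suc d) 1b ++ bs)) k o
                      ⟶[ countCost k s.value ]
                    conf deciding i 0 0 (stack (replicate x 1b ++ bs)) k o)
         (+-suc c.value d) (c.run i (suc d) bs o))
  }
  where
  sk = sinks u (s≤s z≤n)
  ct = sink⇒count k sinks (Sink.value sk) (rs (value<w sk (s≤s z≤n)))
  module s = Sink sk
  module c = Count ct
  adjoint : ∀ j → suc c.value ≤ j ⇔ u < A k j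
  adjoint zero    = mk⇔ (λ ()) λ p → contradiction (subst (u <_) (A-zero k) p) λ where (s≤s ())
  adjoint (suc j) = mk⇔
    (λ { (s≤s p) → subst (u <_) (sym (A-suc k j)) (to (s.adjoint _) (to (c.adjoint j) p)) })
    (λ p → s≤s (from (c.adjoint j) (from (s.adjoint _) (subst (u <_) (A-suc k j) p))))
  open ≤-Reasoning
  x = sinkCost k
  collect : ∀ x u → u + x * u + (1 + x) * u ≡ (1 + x) * (2 * u)
  collect = solve-∀
  enough : suc (x * u + countCost k s.value) ≤ countCost k u
  enough = begin
    1 + x * u + (1 + x) * (2 * s.value)
      ≤⟨ +-mono-≤ (+-monoˡ-≤ (x * u) (s≤s z≤n)) (*-monoʳ-≤ (1 + x) s.shrinks) ⟩
    u + x * u + (1 + x) * u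
      ≡⟨ collect x u ⟩
    (1 + x) * (2 * u) ∎

-- Below a fresh separator, level `k` is applied once and then counted down to 0. The first
-- application leaves no 1 in the digit, so the digit is one less than their number, just what the
-- counter should hold when it is loaded.
count⇒sink : ∀ k → (∀ w → 0 < w → Sink k w) → (∀ u → Count k u) → ∀ w → 0 < w → Sink (suc k) w
count⇒sink k sinks counts w 0<w = record
  { value   = c.value
  ; shrinks = shrinks
  ; adjoint = adjoint
  ; run     = λ i bs o → weaken enough
      (refl ▻ s.run i (0b ∷ bs) o ▻▻ c.run i 0 (0b ∷ bs) o ▻▻
       subst (λ x → conf deciding i 0 0 (stack (replicate (c.value + 0) 1b ++ 0b ∷ bs)) k o
                      ⟶[ suc (c.value + 0 + 1) ] conf deciding i x 0 (stack bs) (suc k) o)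
         (+-identityʳ c.value) (carry-up (c.value + 0) bs))
  }
  where
  module s = Sink (sinks w 0<w)
  module c = Count (counts s.value)
  adjoint : ∀ y → c.value < y ⇔ w < A k y
  adjoint zero    = mk⇔ (λ ()) λ p →
    contradiction 0<w (<⇒≱ (subst (w <_) (A-zero k) p))
  adjoint (suc j) = mk⇔
    (λ { (s≤s p) → subst (w <_) (sym (A-suc k j)) (to (s.adjoint _) (to (c.adjoint j) p)) })
    (λ p → s≤s (from (c.adjoint j) (from (s.adjoint _) (subst (w <_) (A-suc k j) p))))
  open ≤-Reasoning
  x = sinkCost k
  shrinks : 2 * c.value ≤ w
  shrinks = ≤-trans (*-monoʳ-≤ 2 c.value≤) s.shrinks
  regroup : ∀ x w h e → suc (x * w + ((1 + x) * (2 * e) + suc (h + 0 + 1))) ≡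
                        3 * 1 + x * w + (1 + x) * (2 * e) + h
  regroup = solve-∀
  collect : ∀ x w → 3 * w + x * w + (1 + x) * w + w ≡ (2 * x + 5) * w
  collect = solve-∀
  enough : suc (x * w + (countCost k s.value + suc (c.value + 0 + 1))) ≤ (2 * x + 5) * w
  enough = begin
    _
      ≡⟨ regroup x w c.value s.value ⟩
    3 * 1 + x * w + (1 + x) * (2 * s.value) + c.value
      ≤⟨ +-mono-≤ (+-mono-≤ (+-monoˡ-≤ (x * w) (*-monoʳ-≤ 3 0<w))
           (*-monoʳ-≤ (1 + x) s.shrinks)) (≤-trans (m≤m+n _ _) shrinks) ⟩
    3 * w + x * w + (1 + x) * w + w
      ≡⟨ collect x w ⟩
    (2 * x + 5) * w ∎

sink : ∀ k w → 0 < w → Sink k w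
sink zero    = sink-zero
sink (suc k) = count⇒sink k (sink k) (λ u → sink⇒count k (sink k) u (<-wellFounded u))

count : ∀ k u → Count k u
count k u = sink⇒count k (sink k) u (<-wellFounded u)

-- One round: comparing, raising the level, iterating

replicate-shift : ∀ {X : Set} n (x : X) xs → x ∷ replicate n x ++ xs ≡ replicate n x ++ x ∷ xs
replicate-shift zero    x xs = refl
replicate-shift (suc n) x xs = cong (x ∷_) (replicate-shift n x xs)

module _ {i s : Tape (Fin 0)} {v l : ℕ} where

  refill : ∀ u bs → conf refilling i v u s l (stack bs) ⟶[ suc u ]
                    conf deciding i v 0 s l (stack (replicate u 0b ++ bs))
  refill zero    bs = refl ▻ done
  refill (suc u) bs = refl ▻
    subst (λ x → conf refilling i v u s l (stack (0b ∷ bs)) ⟶[ suc u ] conf deciding i v 0 s l (stack x))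
      (sym (replicate-shift u 0b bs)) (refill u (0b ∷ bs))

  -- The 1s that the carry passes are erased and counted in `u`, then written back as 0s, which
  -- returns the head to the end of the number.
  carry : ∀ ds u → conf carrying i v u s l (peek ds) ⟶[ 2 * length ds + 2 + u ]
                   conf deciding i v 0 s l (stack (replicate u 0b ++ increment ds))
  carry []              u = refl ▻ refill u (1b ∷ [])
  carry (zero ∷ ds)     u = weaken (+-monoˡ-≤ u (m≤n+m 2 (2 * suc (length ds))))
                                   (refl ▻ refill u (1b ∷ ds))
  carry (suc zero ∷ ds) u = weaken (≤-reflexive (regroup (length ds) u))
    (cong (λ o → just (conf carrying i v (suc u) s l o)) (moveL-stack ds) ▻
     subst (λ x → conf carrying i v (suc u) s l (peek ds) ⟶[ 2 * length ds + 2 + suc u ]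
                  conf deciding i v 0 s l (stack x))
       (replicate-shift u 0b (increment ds)) (carry ds (suc u)))
    where
    regroup : ∀ n u → suc (2 * n + 2 + suc u) ≡ 2 * suc n + 2 + u
    regroup = solve-∀

module _ {i s o : Tape (Fin 0)} where

  -- Value and level count down together while `u` records how far, so that `restore` can undo it.
  compare-≥ : ∀ k r u → conf comparing i (k + r) u s k o ⟶[ suc k ] conf restoring i r (k + u) s 0 o
  compare-≥ zero    r u = refl ▻ done
  compare-≥ (suc k) r u = refl ▻
    subst (λ x → conf comparing i (k + r) (suc u) s k o ⟶[ suc k ] conf restoring i r x s 0 o)
      (+-suc k u) (compare-≥ k r (suc u))

  compare-< : ∀ d e u → conf comparing i d u s (suc (d + e)) o ⟶[ d ] conf comparing i 0 (d + u) s (suc e) o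
  compare-< zero    e u = done
  compare-< (suc d) e u = refl ▻
    subst (λ x → conf comparing i d (suc u) s (suc (d + e)) o ⟶[ d ] conf comparing i 0 x s (suc e) o)
      (+-suc d u) (compare-< d e (suc u))

  restore : ∀ u v l → conf restoring i v u s l o ⟶[ u ] conf restoring i (u + v) 0 s (u + l) o
  restore zero    v l = done
  restore (suc u) v l = refl ▻
    subst₂ (λ x y → conf restoring i (suc v) u s (suc l) o ⟶[ u ] conf restoring i x 0 s y o)
      (+-suc u v) (+-suc u l) (restore u (suc v) (suc l))

  compare-restore : ∀ k r → conf comparing i (k + r) 0 s k o ⟶[ suc k + k ] conf restoring i (k + r) 0 s k o
  compare-restore k r =
    subst (λ x → conf comparing i (k + r) 0 s k o ⟶[ suc k ] conf restoring i r x s 0 o)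
      (+-identityʳ k) (compare-≥ k r 0) ▻▻
    subst (λ x → conf restoring i r k s 0 o ⟶[ k ] conf restoring i (k + r) 0 s x o)
      (+-identityʳ k) (restore k r 0)

-- Here `d` stands for f k m - 1, so the pending test f k m ≤ k reads d < k.
checkpoint : Tape (Fin 0) → ℕ → ℕ → Config
checkpoint i k d = conf comparing i d 0 (stack []) k (stack (bits k))

length-increment : ∀ ds → length (increment ds) ≤ suc (length ds)
length-increment []              = s≤s z≤n
length-increment (zero ∷ ds)     = n≤1+n _
length-increment (suc zero ∷ ds) = s≤s (length-increment ds)

length-bits : ∀ n → length (bits n) ≤ suc n
length-bits zero    = s≤s z≤n
length-bits (suc n) = ≤-trans (length-increment (bits n)) (s≤s (length-bits n))

1≤2^ : ∀ n → 1 ≤ 2 ^ n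
1≤2^ n = ≤-<-trans z≤n (n<A 0 n)

-- Adding 5 turns the recurrence x ↦ 2x + 5 into plain doubling.
sinkCost+5 : ∀ k → sinkCost k + 5 ≡ 10 * 2 ^ k
sinkCost+5 zero    = refl
sinkCost+5 (suc k) = begin
  2 * sinkCost k + 5 + 5  ≡⟨ regroup (sinkCost k) ⟩
  2 * (sinkCost k + 5)    ≡⟨ cong (2 *_) (sinkCost+5 k) ⟩
  2 * (10 * 2 ^ k)        ≡⟨ swap (2 ^ k) ⟩
  10 * (2 * 2 ^ k)        ∎
  where
  open ≡-Reasoning
  regroup : ∀ x → 2 * x + 5 + 5 ≡ 2 * (x + 5)
  regroup = solve-∀
  swap : ∀ x → 2 * (10 * x) ≡ 10 * (2 * x)
  swap = solve-∀

roundCost : ℕ → ℕ → ℕ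
roundCost k d = 48 * 2 ^ k * suc d

roundCost-mono : ∀ {k k′ d d′} → k ≤ k′ → d ≤ d′ → roundCost k d ≤ roundCost k′ d′
roundCost-mono k≤k′ d≤d′ = *-mono-≤ (*-monoʳ-≤ 48 (^-monoʳ-≤ 2 k≤k′)) (s≤s d≤d′)

-- Since f k has already been applied once to m, counting its further applications from f k m down
-- to 1 gives f (k+1) m - 1, the next `d`.
round : ∀ i k d → k ≤ d →
        checkpoint i k d ⟶[ roundCost k d ] checkpoint i (suc k) (Count.value (count (suc k) d))
round i k d k≤d with m≤n⇒∃[o]m+o≡n k≤d
... | r , refl = weaken enough
  (compare-restore k r ▻▻
   cong (λ o → just (conf carrying i (k + r) 0 (stack []) (suc k) o)) (moveL-stack (bits k)) ▻
   carry (bits k) 0 ▻▻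
   subst (λ x → conf deciding i (k + r) 0 (stack []) (suc k) (stack (bits (suc k)))
                  ⟶[ countCost (suc k) (k + r) ]
                conf deciding i 0 0 (stack (replicate x 1b ++ [])) (suc k) (stack (bits (suc k))))
     (+-identityʳ c.value) (c.run i 0 [] (stack (bits (suc k)))) ▻▻
   complete c.value)
  where
  module c = Count (count (suc k) (k + r))
  open ≤-Reasoning
  x = sinkCost (suc k)
  p = 2 ^ k
  x≤ : x ≤ 20 * p
  x≤ = begin
    x             ≤⟨ m≤m+n x 5 ⟩
    x + 5         ≡⟨ sinkCost+5 (suc k) ⟩
    10 * (2 * p)  ≡⟨ *-assoc 10 2 p ⟨
    20 * p        ∎
  regroup : ∀ k l y h → suc k + k + suc (2 * l + 2 + 0 + (y + suc (h + 1))) ≡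
                        k + k + 2 * l + y + h + 6 * 1
  regroup = solve-∀
  collect : ∀ d p → d + d + 2 * suc d + (1 + 20 * p) * (2 * d) + d + 6 + d ≡ 8 * suc d * 1 + 40 * p * d
  collect = solve-∀
  refactor : ∀ d p → 8 * suc d * p + 40 * p * suc d ≡ 48 * p * suc d
  refactor = solve-∀
  enough : suc k + k + suc (2 * length (bits k) + 2 + 0 + (countCost (suc k) d + suc (c.value + 1)))
           ≤ roundCost k d
  enough = begin
    _
      ≡⟨ regroup k (length (bits k)) (countCost (suc k) d) c.value ⟩
    k + k + 2 * length (bits k) + countCost (suc k) d + c.value + 6
      ≤⟨ +-monoˡ-≤ 6 (+-mono-≤ (+-mono-≤ (+-mono-≤ (+-mono-≤ k≤d k≤d)
           (*-monoʳ-≤ 2 (≤-trans (length-bits k) (s≤s k≤d)))) (*-monoˡ-≤ (2 * d) (s≤s x≤))) c.value≤) ⟩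
    d + d + 2 * suc d + (1 + 20 * p) * (2 * d) + d + 6
      -- The spare `d` rounds the terms without `p` up to 8(d+1).
      ≤⟨ m≤m+n _ d ⟩
    d + d + 2 * suc d + (1 + 20 * p) * (2 * d) + d + 6 + d
      ≡⟨ collect d p ⟩
    8 * suc d * 1 + 40 * p * d
      ≤⟨ +-mono-≤ (*-monoʳ-≤ (8 * suc d) (1≤2^ k)) (*-monoʳ-≤ (40 * p) (n≤1+n d)) ⟩
    8 * suc d * p + 40 * p * suc d
      ≡⟨ refactor d p ⟩
    48 * p * suc d ∎

-- Correctness of the stopping rule

α-unique : ∀ {m k} → m ≤ Ack k → (∀ j → j < k → Ack j < m) → α m ≡ k
α-unique {m} {k} m≤ below-k with least (λ j → m ≤? Ack j) m (<⇒≤ (n<A m m))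
... | a , m≤a , a-least = ≤-antisym (a-least k m≤)
  (≮⇒≥ λ a<k → <⇒≱ (below-k a a<k) m≤a)

record Outputs (m : ℕ) (c : Config) (T : ℕ) : Set where
  constructor outputs
  field
    {final} : Config
    run     : c ⟶[ T ] final
    stops   : trimmedStep final ≡ nothing
    holds   : TuringMachine.output machine final ≡ stack (bits (α m))

precede : ∀ {m c d S T} → c ⟶[ S ] d → Outputs m d T → Outputs m c (S + T)
precede r (outputs r′ stops holds) = outputs (r ▻▻ r′) stops holds

weakenOutputs : ∀ {m c S T} → S ≤ T → Outputs m c S → Outputs m c T
weakenOutputs S≤T (outputs r stops holds) = outputs (weaken S≤T r) stops holds

-- Equivalently, suc d is the value at m of the inverse of A k.
record Checkpoint (m k d : ℕ) : Set where
  field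
    adjoint : ∀ j → d < j ⇔ m ≤ A k j
    failed  : ∀ j → j < k → Ack j < m

-- The adjunctions compose because A (k+1) (j+1) = A k (A (k+1) j). Level `k` itself fails, as m ≤ A
-- k k would give d < k.
advance : ∀ {m k d} → 1 < m → k ≤ d → Checkpoint m k d → Checkpoint m (suc k) (Count.value (count (suc k) d))
advance {m} {k} {d} 1<m k≤d cp = record { adjoint = adjoint′ ; failed = failed′ }
  where
  open Checkpoint cp
  module c = Count (count (suc k) d)
  adjoint′ : ∀ j → c.value < j ⇔ m ≤ A (suc k) j
  adjoint′ zero    = mk⇔ (λ ()) λ p → contradiction p (<⇒≱ 1<m)
  adjoint′ (suc j) = mk⇔
    (λ { (s≤s p) → to (adjoint _) (to (c.adjoint j) p) })
    (λ p → s≤s (from (c.adjoint j) (from (adjoint _) p)))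
  failed′ : ∀ j → j < suc k → Ack j < m
  failed′ j (s≤s j≤k) with m≤n⇒m<n∨m≡n j≤k
  ... | inj₁ j<k  = failed j j<k
  ... | inj₂ refl = ≰⇒> λ m≤ → <⇒≱ (from (adjoint k) m≤) k≤d

finish : ∀ {m} i k d → d < k → Checkpoint m k d → Outputs m (checkpoint i k d) d
finish {m} i k d d<k cp with m≤n⇒∃[o]m+o≡n d<k
... | e , refl = outputs (compare-< d e 0) refl
  (cong (stack ∘ bits) (sym (α-unique (to (adjoint k) d<k) failed)))
  where open Checkpoint cp

-- The fuel `g` suffices because each round raises the level and never raises the value. All levels
-- at which a round starts, and all values, stay below or at `X`, which bounds every round
-- uniformly.
rounds : ∀ {m} i X g k d → 1 < m → d < k + g → d ≤ X → Checkpoint m k d →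
         Outputs m (checkpoint i k d) (g * roundCost X X + X)
rounds i X g k d 1<m d<k+g d≤X cp with d <? k
... | yes d<k = weakenOutputs (≤-trans d≤X (m≤n+m X (g * roundCost X X))) (finish i k d d<k cp)
rounds i X zero    k d 1<m d<k+g d≤X cp | no d≮k =
  contradiction (subst (d <_) (+-identityʳ k) d<k+g) d≮k
rounds i X (suc g) k d 1<m d<k+g d≤X cp | no d≮k = weakenOutputs
  (≤-trans (+-monoˡ-≤ _ (roundCost-mono (≤-trans k≤d d≤X) d≤X))
           (≤-reflexive (sym (+-assoc (roundCost X X) (g * roundCost X X) X))))
  (precede (round i k d k≤d)
    (rounds i X g (suc k) c.value 1<m
      (≤-<-trans c.value≤ (subst (d <_) (+-suc k g) d<k+g)) (≤-trans c.value≤ d≤X) (advance 1<m k≤d cp)))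
  where
  k≤d = ≮⇒≥ d≮k
  module c = Count (count (suc k) d)

-- Exponential cost in log* is linear

3n≤2^n+5 : ∀ n → 3 * n ≤ 2 ^ n + 5
3n≤2^n+5 0 = z≤n
3n≤2^n+5 1 = s≤s (s≤s (s≤s z≤n))
3n≤2^n+5 2 = s≤s (s≤s (s≤s (s≤s (s≤s (s≤s z≤n)))))
3n≤2^n+5 (suc n@(suc (suc _))) = begin
  3 * suc n            ≡⟨ *-suc 3 n ⟩
  3 + 3 * n            ≤⟨ +-mono-≤ 3≤ (3n≤2^n+5 n) ⟩
  2 ^ n + (2 ^ n + 5)  ≡⟨ regroup (2 ^ n) ⟩
  2 ^ suc n + 5        ∎
  where
  open ≤-Reasoning
  regroup : ∀ x → x + (x + 5) ≡ 2 * x + 5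
  regroup = solve-∀
  3≤ : 3 ≤ 2 ^ n
  3≤ = ≤-trans (s≤s (s≤s (s≤s z≤n))) (^-monoʳ-≤ 2 {2} {n} (s≤s (s≤s z≤n)))

3n≤A1n+5 : ∀ n → 3 * n ≤ A 1 n + 5
3n≤A1n+5 zero    = z≤n
3n≤A1n+5 (suc n) = ≤-trans (3n≤2^n+5 (suc n)) (+-monoˡ-≤ 5 (^-monoʳ-≤ 2 (n<A 1 n)))

-- `A 1` is a tower of 2s, and A 1 (n+1) = 2 ^ A 1 n, so it is enough to compare exponents; the 5
-- there becomes the factor 32.
8^≤ : ∀ n → 8 ^ n ≤ 32 * A 1 (suc n)
8^≤ n = begin
  8 ^ n                ≡⟨ ^-*-assoc 2 3 n ⟩
  2 ^ (3 * n)          ≤⟨ ^-monoʳ-≤ 2 (3n≤A1n+5 n) ⟩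
  2 ^ (A 1 n + 5)      ≡⟨ ^-distribˡ-+-* 2 (A 1 n) 5 ⟩
  2 ^ A 1 n * 32       ≡⟨ *-comm (2 ^ A 1 n) 32 ⟩
  32 * A 1 (suc n)     ∎
  where open ≤-Reasoning

module _ {d : ℕ} (c : Count 1 d) where

  open Count c

  -- value is about log* d.
  8^value≤ : 8 ^ value ≤ 2048 * suc d
  8^value≤ with value | adjoint
  ... | 0           | _   = s≤s z≤n
  ... | 1           | _   = ≤-trans (m≤m+n 8 2040)
    (≤-trans (≤-reflexive (sym (*-identityʳ 2048))) (*-monoʳ-≤ 2048 (s≤s z≤n)))
  -- The adjunction only reaches A 1 (n+1) ≤ d, while 8^≤ handles 8 ^ n; the two remaining factors 8
  -- go into 2048 = 64 · 32.
  ... | suc (suc n) | adj = begin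
    8 * (8 * 8 ^ n)              ≡⟨ *-assoc 8 8 (8 ^ n) ⟨
    64 * 8 ^ n                   ≤⟨ *-monoʳ-≤ 64 (8^≤ n) ⟩
    64 * (32 * A 1 (suc n))      ≡⟨ *-assoc 64 32 (A 1 (suc n)) ⟨
    2048 * A 1 (suc n)           ≤⟨ *-monoʳ-≤ 2048 (≤-trans A≤d (n≤1+n d)) ⟩
    2048 * suc d                 ∎
    where
    open ≤-Reasoning
    A≤d : A 1 (suc n) ≤ d
    A≤d = ≮⇒≥ λ d<A → <-irrefl refl (from (adj (suc n)) d<A)

-- Each of the n rounds costs 48 · 2^n · (n+1), and n < 2^n, so three factors 2^n suffice. The 49th
-- copy pays for the last comparison.
tail≤ : ∀ n → n * roundCost n n + n ≤ 49 * 8 ^ n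
tail≤ n = begin
  n * (48 * p * suc n) + n    ≤⟨ +-mono-≤ (*-mono-≤ n≤p (*-monoʳ-≤ (48 * p) n<p)) n≤ppp ⟩
  p * (48 * p * p) + p * (p * p) ≡⟨ collect p ⟩
  49 * (p * (p * p))          ≡⟨ cong (49 *_) ppp ⟩
  49 * 8 ^ n                  ∎
  where
  open ≤-Reasoning
  p = 2 ^ n
  n<p : n < p
  n<p = n<A 0 n
  n≤p = <⇒≤ n<p
  n≤ppp : n ≤ p * (p * p)
  n≤ppp = ≤-trans n≤p (≤-trans (≤-reflexive (sym (*-identityʳ p)))
            (*-monoʳ-≤ p (*-mono-≤ (1≤2^ n) (1≤2^ n))))
  collect : ∀ p → p * (48 * p * p) + p * (p * p) ≡ 49 * (p * (p * p))
  collect = solve-∀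
  ppp : p * (p * p) ≡ 8 ^ n
  ppp = begin-equality
    p * (p * p)   ≡⟨ cong (λ x → p * (p * x)) (*-identityʳ p) ⟨
    p ^ 3         ≡⟨ ^-*-assoc 2 n 3 ⟩
    2 ^ (n * 3)   ≡⟨ cong (2 ^_) (*-comm n 3) ⟩
    2 ^ (3 * n)   ≡⟨ ^-*-assoc 2 3 n ⟨
    8 ^ n         ∎

-- Abstract, since the factor is too large to be unfolded in unary.
abstract

  factor : ℕ
  factor = 48 + 49 * 2048

  -- The round at level 0 is charged separately, at 48(d+1). After it, values and levels are bounded
  -- by its result, about log* d, and `8^value≤` absorbs the rest.
  checkpoint-outputs : ∀ {m} i d → 2 ^ d < m → m ≤ 2 ^ suc d → Outputs m (checkpoint i 0 d) (factor * suc d)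
  checkpoint-outputs {m} i d 2^d<m m≤ = weakenOutputs enough
    (precede (round i 0 d z≤n) (rounds i c.value c.value 1 c.value 1<m ≤-refl ≤-refl (advance 1<m z≤n cp)))
    where
    module c = Count (count 1 d)
    1<m : 1 < m
    1<m = ≤-<-trans (1≤2^ d) 2^d<m
    cp : Checkpoint m 0 d
    cp = record
      { adjoint = λ j → mk⇔ (λ d<j → ≤-trans m≤ (^-monoʳ-≤ 2 d<j))
                            (λ m≤2^j → ≰⇒> λ j≤d → <⇒≱ 2^d<m (≤-trans m≤2^j (^-monoʳ-≤ 2 j≤d)))
      ; failed  = λ _ () }
    open ≤-Reasoning
    enough : 48 * suc d + (c.value * roundCost c.value c.value + c.value) ≤ factor * suc d
    enough = begin
      48 * suc d + (c.value * roundCost c.value c.value + c.value)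
        ≤⟨ +-monoʳ-≤ (48 * suc d) (≤-trans (tail≤ c.value) (*-monoʳ-≤ 49 (8^value≤ (count 1 d)))) ⟩
      48 * suc d + 49 * (2048 * suc d)   ≡⟨ cong (48 * suc d +_) (*-assoc 49 2048 (suc d)) ⟨
      48 * suc d + 49 * 2048 * suc d     ≡⟨ *-distribʳ-+ (suc d) 48 (49 * 2048) ⟨
      factor * suc d                          ∎

-- Scanning the input

reading : List Sym → List Bit → Tape (Fin 0)
reading ls []       = tape ls blank []
reading ls (b ∷ bs) = tape ls (bit b) (List.map bit bs)

moveR-reading : ∀ ls x bs → trimmedMove R (tape ls x (List.map bit bs)) ≡ reading (x ∷ ls) bs
moveR-reading ls x []       = refl
moveR-reading ls x (b ∷ bs) = refl

wordTape-reading : ∀ bs → wordTape bs ≡ reading [] bs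
wordTape-reading []       = refl
wordTape-reading (b ∷ bs) = refl

horner : ℕ → List Bit → ℕ
horner x []       = x
horner x (b ∷ bs) = horner (toℕ b + x * 2) bs

horner-∷ʳ : ∀ x bs b → horner x (bs ++ b ∷ []) ≡ toℕ b + horner x bs * 2
horner-∷ʳ x []       b = refl
horner-∷ʳ x (c ∷ bs) b = horner-∷ʳ (toℕ c + x * 2) bs b

horner-reverse : ∀ ds → horner 0 (reverse ds) ≡ fromDigits ds
horner-reverse []       = refl
horner-reverse (d ∷ ds) = begin
  horner 0 (reverse (d ∷ ds))         ≡⟨ cong (horner 0) (unfold-reverse d ds) ⟩
  horner 0 (reverse ds ++ d ∷ [])     ≡⟨ horner-∷ʳ 0 (reverse ds) d ⟩
  toℕ d + horner 0 (reverse ds) * 2   ≡⟨ cong (λ x → toℕ d + x * 2) (horner-reverse ds) ⟩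
  toℕ d + fromDigits ds * 2           ∎
  where open ≡-Reasoning

horner-binary : ∀ m → horner 0 (binary m) ≡ m
horner-binary m = begin
  horner 0 (binary m)                       ≡⟨ cong (horner 0) (reverse-involutive (binary m)) ⟨
  horner 0 (reverse (reverse (binary m)))   ≡⟨ horner-reverse (reverse (binary m)) ⟩
  fromDigits (reverse (binary m))           ≡⟨ fromDigits-binary m ⟩
  m                                         ∎
  where open ≡-Reasoning

-- With `n` bits unread and the counter at `r`, the first checkpoint will have a value of at most r
-- + n, a sum that reading a bit in the counting states preserves.
scanCost : ℕ → ℕ → ℕ
scanCost n r = suc n + factor * suc (r + n)

scanCost-suc : ∀ n r → suc (scanCost n (suc r)) ≡ scanCost (suc n) r
scanCost-suc n r = cong (λ x → suc (suc n + factor * suc x)) (sym (+-suc r n))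

scanning : Fin 14 → List Sym → List Bit → ℕ → Config
scanning q ls bs r = conf q (reading ls bs) r 0 (stack []) 0 (stack (0b ∷ []))

scanStep : ∀ {m q q′ ls b bs r r′ T} →
           trimmedStep (scanning q ls (b ∷ bs) r) ≡
             just (conf q′ (trimmedMove R (tape ls (bit b) (List.map bit bs)))
                     r′ 0 (stack []) 0 (stack (0b ∷ []))) →
           Outputs m (scanning q′ (bit b ∷ ls) bs r′) T → Outputs m (scanning q ls (b ∷ bs) r) (suc T)
scanStep {ls = ls} {b} {bs} e out =
  precede (trans e (cong (λ i → just (conf _ i _ 0 (stack []) 0 (stack (0b ∷ []))))
                     (moveR-reading ls (bit b) bs)) ▻ done {t = 0}) out

-- Appending a bit keeps the prefix strictly between consecutive powers of 2, so at the end f 0 m =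
-- r + 1 and the counter is already right.
scanNonPower : ∀ bs ls r x → 2 ^ r < x → x < 2 ^ suc r →
               Outputs (horner x bs) (scanning nonPower ls bs r) (scanCost (length bs) r)
scanNonPower [] ls r x lo hi =
  precede (refl ▻ done {t = 0})
    (weakenOutputs (*-monoʳ-≤ factor (s≤s (m≤m+n r 0))) (checkpoint-outputs _ r lo (<⇒≤ hi)))
scanNonPower (b ∷ bs) ls r x lo hi = weakenOutputs (≤-reflexive (scanCost-suc (length bs) r))
  (scanStep refl (scanNonPower bs (bit b ∷ ls) (suc r) (toℕ b + x * 2)
    (≤-trans (*-monoʳ-< 2 lo) (≤-trans (≤-reflexive (*-comm 2 x)) (m≤n+m (x * 2) (toℕ b))))
    (<-≤-trans (+-monoˡ-< (x * 2) (toℕ<n b))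
      (≤-trans (≤-reflexive (*-comm (suc x) 2)) (*-monoʳ-≤ 2 hi)))))

-- An exact power 2^r takes r halvings, one fewer than the larger numbers of the same length, so the
-- counter steps back once at the end.
scanPowerOfTwo : ∀ bs ls r →
                 Outputs (horner (2 ^ r) bs) (scanning powerOfTwo ls bs r) (scanCost (length bs) r)
-- For m = 1 the counter cannot step back; the machine halts on the preset output 0, which is α 1.
scanPowerOfTwo [] ls zero    = outputs done refl refl
scanPowerOfTwo [] ls (suc r) =
  precede (refl ▻ done {t = 0})
    (weakenOutputs (*-monoʳ-≤ factor (≤-trans (n≤1+n (suc r)) (s≤s (m≤m+n (suc r) 0))))
      (checkpoint-outputs _ r (^-monoʳ-< 2 ≤-refl (n<1+n r)) ≤-refl))
scanPowerOfTwo (zero ∷ bs) ls r = weakenOutputs (≤-reflexive (scanCost-suc (length bs) r))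
  (scanStep refl
    (subst (λ x → Outputs (horner x bs) (scanning powerOfTwo (O ∷ ls) bs (suc r))
                    (scanCost (length bs) (suc r)))
    (*-comm 2 (2 ^ r)) (scanPowerOfTwo bs (O ∷ ls) (suc r))))
scanPowerOfTwo (suc zero ∷ bs) ls r = weakenOutputs (≤-reflexive (scanCost-suc (length bs) r))
  (scanStep refl (scanNonPower bs (I ∷ ls) (suc r) (1 + 2 ^ r * 2)
    (s≤s (≤-reflexive (*-comm 2 (2 ^ r))))
    (≤-trans (s≤s (s≤s (≤-reflexive (*-comm (2 ^ r) 2))))
      (+-mono-≤ {2} (*-monoʳ-≤ 2 (1≤2^ r)) (m≤m+n (2 ^ suc r) 0)))))

scanLeading : ∀ bs ls → Outputs (horner 0 bs) (scanning leading ls bs 0) (scanCost (length bs) 0)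
-- Only zeros were read, and the preset output 0 is α 0.
scanLeading []              ls = outputs done refl refl
scanLeading (zero ∷ bs)     ls = weakenOutputs shorter (scanStep refl (scanLeading bs (O ∷ ls)))
  where shorter = s≤s (s≤s (+-monoʳ-≤ (length bs) (*-monoʳ-≤ factor (n≤1+n (suc (length bs))))))
scanLeading (suc zero ∷ bs) ls = weakenOutputs shorter (scanStep refl (scanPowerOfTwo bs (I ∷ ls) 0))
  where shorter = s≤s (s≤s (+-monoʳ-≤ (length bs) (*-monoʳ-≤ factor (n≤1+n (suc (length bs))))))

initial-outputs : ∀ m → Outputs m (TuringMachine.initial machine (binary m)) (suc (scanCost ∣ m ∣₂ 0))
initial-outputs m =
  subst₂ (λ w x → Outputs x (config starting (w ∷ Vec.replicate 5 blankTape)) (suc (scanCost ∣ m ∣₂ 0)))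
    (sym (wordTape-reading (binary m))) (horner-binary m)
    (precede (refl ▻ done {t = 0}) (scanLeading (binary m) []))

-- The output and the linear bound

≈stack⇒Holds : ∀ {t bs} → t ≈ stack bs → t Holds reverse bs
≈stack⇒Holds {bs = bs} (tape _ _ p) with ≋[]⇒blanks p
-- `suc j` counts the blank under the head, just past the last digit, and the untrimmed ones.
... | j , refl = 0 , suc j , cong (_++ blank ∷ replicate j blank) (sym (reverse-map bit bs))

1≤∣m∣₂ : ∀ m → 1 ≤ ∣ m ∣₂
1≤∣m∣₂ m = subst (1 ≤_) (sym (length-binary m)) (m≤n+m 1 _)

scanCost-linear : ∀ {n} → 1 ≤ n → suc (scanCost n 0) ≤ (3 + 2 * factor) * n
scanCost-linear {n} 1≤n = begin
  2 + n + factor * (1 + n)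
    ≤⟨ +-mono-≤ (+-monoˡ-≤ n (*-monoʳ-≤ 2 1≤n)) (*-monoʳ-≤ factor (+-monoˡ-≤ n 1≤n)) ⟩
  2 * n + n + factor * (n + n)
    ≡⟨ collect n factor ⟩
  (3 + 2 * factor) * n ∎
  where
  open ≤-Reasoning
  collect : ∀ n k → 2 * n + n + k * (n + n) ≡ (3 + 2 * k) * n
  collect = solve-∀

machine-computes-α : machine computes α inTime λ n → (3 + 2 * factor) * n
machine-computes-α m with initial-outputs m
... | outputs run stops holds with simulate (Pointwise.refl ≈-refl) run stops
...   | t , c , halts , t≤ , out =
  t , c , halts , ≤-trans t≤ (scanCost-linear (1≤∣m∣₂ m)) , ≈stack⇒Holds (subst (_ ≈_) holds out)

proposition6p5 : LinearTimeComputable α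
proposition6p5 = machine , 3 + 2 * factor , machine-computes-α
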